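{- Let $n=2^k$ with $k>2$ an integer, and let $G=\langle 2^{k-1}-1\rangle$ be the subgroup of $\mathbb{Z}_n^\times$ generated by $2^{k-1}-1$. Then the coset index function $f_G$ is a $(2^k,2^{k-1}+1,\{0,2\})$ zero-difference function.
   Context: For a subgroup $G$ of $\mathbb{Z}_n^\times$ and $r\in\mathbb{Z}_n$, the coset $rG=\{rg\mid g\in G\}$; these cosets partition $\mathbb{Z}_n$, forming a set $D_G$. The coset index function induced by $G$ is $f_G:\mathbb{Z}_n\to\mathbb{Z}_{|D_G|}$, $f_G(x)=h_G(C_x)$, where $C_x$ is the coset containing $x$ and $h_G:D_G\to\mathbb{Z}_{|D_G|}$ is a fixed bijection. A function $f:A\to B$ between finite abelian groups is an $(n,m,S)$ zero-difference function if $n=|A|$, $m=|f(A)|$, and for every nonzero $a\in A$, $|\{x\in A\mid f(x+a)=f(x)\}|\in S$. Here $A=(\mathbb{Z}_n,+)$. -}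

module Defs where

open import Algebra.Bundles using (AbelianGroup; CommutativeRing; Group)
open import Algebra.Definitions using (Invertible)
open import Data.Fin.Base using (Fin; toℕ)
open import Data.Fin.Properties
  using (toℕ-injective; toℕ-fromℕ<; toℕ<n; toℕ≤n; nonZeroIndex)
open import Data.Nat.Base hiding (_⊔_)
open import Data.Nat.DivMod
open import Data.Nat.Properties using (m^n≢0; *-suc; suc-pred)
open import Data.Nat.Solver using (module +-*-Solver)
open import Data.Product.Base using (∃; _×_; _,_; proj₁; proj₂)
open import Function.Bundles using (Func; Bijection)
open import Level using (Level; 0ℓ; _⊔_) renaming (suc to lsuc)
open import Relation.Binary.Bundles using (Setoid)
import Relation.Binary.Construct.On as On
open import Relation.Binary.PropositionalEquality
  using (_≡_; refl; sym; trans; cong; cong₂; isEquivalence; module ≡-Reasoning)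
  renaming (setoid to ≡-setoid)
open import Relation.Nullary.Negation using (¬_)
open import Relation.Unary using (Pred; _∈_; _≐_)
open import Relation.Unary.Relation.Binary.Equality using (≐-setoid)

private
  variable
    a b c ℓ p : Level

infix 4 _HasSize_

_HasSize_ : Setoid a ℓ → ℕ → Set _
S HasSize n = Bijection S (≡-setoid (Fin n))

-- A subset as a setoid: membership proofs are ignored, so that elements
-- are not counted with multiplicity.
subsetoid : (S : Setoid a ℓ) → Pred (Setoid.Carrier S) p → Setoid _ _
subsetoid S P = On.setoid S (proj₁ {B = P})

module _ {a ℓ₁ b ℓ₂} (A : AbelianGroup a ℓ₁) (B : AbelianGroup b ℓ₂) where

  private
    module A = AbelianGroup A
    module B = AbelianGroup B

  record IsZeroDifference
           (n m : ℕ) (S : Pred ℕ p) (f : Func A.setoid B.setoid) :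
           Set (a ⊔ ℓ₁ ⊔ b ⊔ ℓ₂ ⊔ p) where
    open Func f renaming (to to ⟦_⟧) using ()
    field
      domain-size     : A.setoid HasSize n
      codomain-finite : ∃ λ l → B.setoid HasSize l
      image-size      :
        subsetoid B.setoid (λ y → ∃ λ x → ⟦ x ⟧ B.≈ y) HasSize m
      zero-difference : ∀ d → ¬ d A.≈ A.ε →
        ∃ λ s → s ∈ S ×
          subsetoid A.setoid (λ x → ⟦ x A.∙ d ⟧ B.≈ ⟦ x ⟧) HasSize s

module _ (G : Group c ℓ) where

  open Group G

  record Subgroup p : Set (c ⊔ ℓ ⊔ lsuc p) where
    field
      Member    : Pred Carrier p
      resp      : ∀ {x y} → x ≈ y → Member x → Member y
      ε-closed  : Member ε
      ∙-closed  : ∀ {x y} → Member x → Member y → Member (x ∙ y)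
      ⁻¹-closed : ∀ {x} → Member x → Member (x ⁻¹)

  -- The least subgroup containing g, as a predicate.
  data Generated (g : Carrier) : Pred Carrier (c ⊔ ℓ) where
    gen    : Generated g g
    ≈-gen  : ∀ {x y} → x ≈ y → Generated g x → Generated g y
    ε-gen  : Generated g ε
    ∙-gen  : ∀ {x y} → Generated g x → Generated g y → Generated g (x ∙ y)
    ⁻¹-gen : ∀ {x} → Generated g x → Generated g (x ⁻¹)

  ⟨_⟩ : Carrier → Subgroup (c ⊔ ℓ)
  ⟨ g ⟩ = record
    { Member    = Generated g
    ; resp      = ≈-gen
    ; ε-closed  = ε-gen
    ; ∙-closed  = ∙-gen
    ; ⁻¹-closed = ⁻¹-gen
    }

module _ (R : CommutativeRing c ℓ) where

  open CommutativeRing R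
    using (Carrier; _≈_; 1#; setoid; *-assoc; *-comm; *-cong; *-congˡ; *-congʳ;
           *-identityˡ; *-identityʳ)
    renaming (_*_ to _·_)
  open import Relation.Binary.Reasoning.Setoid setoid

  IsUnit : Pred Carrier (c ⊔ ℓ)
  IsUnit = Invertible _≈_ 1# _·_

  private
    interchange : ∀ u v w z → (u · v) · (w · z) ≈ (u · w) · (v · z)
    interchange u v w z = begin
      (u · v) · (w · z) ≈⟨ *-assoc u v (w · z) ⟩
      u · (v · (w · z)) ≈⟨ *-congˡ (*-assoc v w z) ⟨
      u · ((v · w) · z) ≈⟨ *-congˡ (*-congʳ (*-comm v w)) ⟩
      u · ((w · v) · z) ≈⟨ *-congˡ (*-assoc w v z) ⟩
      u · (w · (v · z)) ≈⟨ *-assoc u w (v · z) ⟨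
      (u · w) · (v · z) ∎

    product-inverse : ∀ {u v w z} → u · w ≈ 1# → v · z ≈ 1# →
                      (u · v) · (w · z) ≈ 1#
    product-inverse {u} {v} {w} {z} uw vz = begin
      (u · v) · (w · z) ≈⟨ interchange u v w z ⟩
      (u · w) · (v · z) ≈⟨ *-cong uw vz ⟩
      1# · 1#           ≈⟨ *-identityˡ 1# ⟩
      1#                ∎

    inverse-cong : ∀ {x y} ((x⁻¹ , _) : IsUnit x) ((y⁻¹ , _) : IsUnit y) →
                   x ≈ y → x⁻¹ ≈ y⁻¹
    inverse-cong {x} {y} (x⁻¹ , x⁻¹x , _) (y⁻¹ , _ , yy⁻¹) x≈y = begin
      x⁻¹             ≈⟨ *-identityʳ x⁻¹ ⟨
      x⁻¹ · 1#        ≈⟨ *-congˡ yy⁻¹ ⟨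
      x⁻¹ · (y · y⁻¹) ≈⟨ *-assoc x⁻¹ y y⁻¹ ⟨
      (x⁻¹ · y) · y⁻¹ ≈⟨ *-congʳ (*-congˡ x≈y) ⟨
      (x⁻¹ · x) · y⁻¹ ≈⟨ *-congʳ x⁻¹x ⟩
      1# · y⁻¹        ≈⟨ *-identityˡ y⁻¹ ⟩
      y⁻¹             ∎

  infix 9 _ˣ

  _ˣ : Group (c ⊔ ℓ) ℓ
  _ˣ = record
    { Carrier = ∃ IsUnit
    ; _≈_     = λ u v → proj₁ u ≈ proj₁ v
    ; _∙_     = λ (u , u⁻¹ , u⁻¹u , uu⁻¹) (v , v⁻¹ , v⁻¹v , vv⁻¹) →
                  u · v , u⁻¹ · v⁻¹ ,
                  product-inverse u⁻¹u v⁻¹v , product-inverse uu⁻¹ vv⁻¹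
    ; ε       = 1# , 1# , *-identityˡ 1# , *-identityˡ 1#
    ; _⁻¹     = λ (u , u⁻¹ , u⁻¹u , uu⁻¹) → u⁻¹ , u , uu⁻¹ , u⁻¹u
    ; isGroup = record
      { isMonoid = record
        { isSemigroup = record
          { isMagma = record
            { isEquivalence = On.isEquivalence proj₁ (Setoid.isEquivalence setoid)
            ; ∙-cong        = *-cong
            }
          ; assoc = λ u v w → *-assoc (proj₁ u) (proj₁ v) (proj₁ w)
          }
        ; identity = (λ u → *-identityˡ (proj₁ u)) , (λ u → *-identityʳ (proj₁ u))
        }
      ; inverse = (λ (_ , _ , u⁻¹u , _) → u⁻¹u) , (λ (_ , _ , _ , uu⁻¹) → uu⁻¹)
      ; ⁻¹-cong = λ {u} {v} → inverse-cong (proj₂ u) (proj₂ v)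
      }
    }

module Modular (n : ℕ) .{{_ : NonZero n}} where

  open import Data.Nat.Properties
    using (+-assoc; +-comm; *-assoc; *-comm; *-identityˡ; *-distribˡ-+; m∸n+n≡m)
  open ≡-Reasoning

  infixl 6 _⊕_
  infixl 7 _⊗_

  _⊕_ _⊗_ : Fin n → Fin n → Fin n
  x ⊕ y = (toℕ x + toℕ y) mod n
  x ⊗ y = (toℕ x * toℕ y) mod n

  ⊖_ : Fin n → Fin n
  ⊖ x = (n ∸ toℕ x) mod n

  0′ 1′ : Fin n
  0′ = 0 mod n
  1′ = 1 mod n

  toℕ-mod : ∀ m → toℕ (m mod n) ≡ m % n
  toℕ-mod m = toℕ-fromℕ< (m%n<n m n)

  mod-cong : ∀ {l m} → l % n ≡ m % n → l mod n ≡ m mod n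
  mod-cong {l} {m} eq =
    toℕ-injective (trans (toℕ-mod l) (trans eq (sym (toℕ-mod m))))

  mod-toℕ : ∀ x → toℕ x mod n ≡ x
  mod-toℕ x = toℕ-injective (trans (toℕ-mod (toℕ x)) (m<n⇒m%n≡m (toℕ<n x)))

  mod-⊕ : ∀ l m → (l mod n) ⊕ (m mod n) ≡ (l + m) mod n
  mod-⊕ l m = trans
    (cong (_mod n) (cong₂ _+_ (toℕ-mod l) (toℕ-mod m)))
    (mod-cong (sym (%-distribˡ-+ l m n)))

  mod-⊗ : ∀ l m → (l mod n) ⊗ (m mod n) ≡ (l * m) mod n
  mod-⊗ l m = trans
    (cong (_mod n) (cong₂ _*_ (toℕ-mod l) (toℕ-mod m)))
    (mod-cong (sym (%-distribˡ-* l m n)))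

  ⊕-comm : ∀ x y → x ⊕ y ≡ y ⊕ x
  ⊕-comm x y = cong (_mod n) (+-comm (toℕ x) (toℕ y))

  ⊗-comm : ∀ x y → x ⊗ y ≡ y ⊗ x
  ⊗-comm x y = cong (_mod n) (*-comm (toℕ x) (toℕ y))

  ⊕-assoc : ∀ x y z → (x ⊕ y) ⊕ z ≡ x ⊕ (y ⊕ z)
  ⊕-assoc x y z = begin
    (x ⊕ y) ⊕ z                         ≡⟨ cong ((x ⊕ y) ⊕_) (mod-toℕ z) ⟨
    (x ⊕ y) ⊕ (toℕ z mod n)             ≡⟨ mod-⊕ (toℕ x + toℕ y) (toℕ z) ⟩
    (toℕ x + toℕ y + toℕ z) mod n       ≡⟨ cong (_mod n) (+-assoc (toℕ x) (toℕ y) (toℕ z)) ⟩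
    (toℕ x + (toℕ y + toℕ z)) mod n     ≡⟨ mod-⊕ (toℕ x) (toℕ y + toℕ z) ⟨
    (toℕ x mod n) ⊕ (y ⊕ z)             ≡⟨ cong (_⊕ (y ⊕ z)) (mod-toℕ x) ⟩
    x ⊕ (y ⊕ z)                         ∎

  ⊗-assoc : ∀ x y z → (x ⊗ y) ⊗ z ≡ x ⊗ (y ⊗ z)
  ⊗-assoc x y z = begin
    (x ⊗ y) ⊗ z                         ≡⟨ cong ((x ⊗ y) ⊗_) (mod-toℕ z) ⟨
    (x ⊗ y) ⊗ (toℕ z mod n)             ≡⟨ mod-⊗ (toℕ x * toℕ y) (toℕ z) ⟩
    (toℕ x * toℕ y * toℕ z) mod n       ≡⟨ cong (_mod n) (*-assoc (toℕ x) (toℕ y) (toℕ z)) ⟩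
    (toℕ x * (toℕ y * toℕ z)) mod n     ≡⟨ mod-⊗ (toℕ x) (toℕ y * toℕ z) ⟨
    (toℕ x mod n) ⊗ (y ⊗ z)             ≡⟨ cong (_⊗ (y ⊗ z)) (mod-toℕ x) ⟩
    x ⊗ (y ⊗ z)                         ∎

  ⊕-identityˡ : ∀ x → 0′ ⊕ x ≡ x
  ⊕-identityˡ x = begin
    0′ ⊕ x              ≡⟨ cong (0′ ⊕_) (mod-toℕ x) ⟨
    0′ ⊕ (toℕ x mod n)  ≡⟨ mod-⊕ 0 (toℕ x) ⟩
    toℕ x mod n         ≡⟨ mod-toℕ x ⟩
    x                   ∎

  ⊗-identityˡ : ∀ x → 1′ ⊗ x ≡ x
  ⊗-identityˡ x = begin
    1′ ⊗ x               ≡⟨ cong (1′ ⊗_) (mod-toℕ x) ⟨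
    1′ ⊗ (toℕ x mod n)   ≡⟨ mod-⊗ 1 (toℕ x) ⟩
    (1 * toℕ x) mod n    ≡⟨ cong (_mod n) (*-identityˡ (toℕ x)) ⟩
    toℕ x mod n          ≡⟨ mod-toℕ x ⟩
    x                    ∎

  ⊖-inverseˡ : ∀ x → (⊖ x) ⊕ x ≡ 0′
  ⊖-inverseˡ x = begin
    (⊖ x) ⊕ x                     ≡⟨ cong ((⊖ x) ⊕_) (mod-toℕ x) ⟨
    (⊖ x) ⊕ (toℕ x mod n)         ≡⟨ mod-⊕ (n ∸ toℕ x) (toℕ x) ⟩
    (n ∸ toℕ x + toℕ x) mod n     ≡⟨ cong (_mod n) (m∸n+n≡m (toℕ≤n x)) ⟩
    n mod n                       ≡⟨ mod-cong ([m+n]%n≡m%n 0 n) ⟩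
    0′                            ∎

  ⊗-distribˡ-⊕ : ∀ x y z → x ⊗ (y ⊕ z) ≡ (x ⊗ y) ⊕ (x ⊗ z)
  ⊗-distribˡ-⊕ x y z = begin
    x ⊗ (y ⊕ z)                             ≡⟨ cong (_⊗ (y ⊕ z)) (mod-toℕ x) ⟨
    (toℕ x mod n) ⊗ (y ⊕ z)                 ≡⟨ mod-⊗ (toℕ x) (toℕ y + toℕ z) ⟩
    (toℕ x * (toℕ y + toℕ z)) mod n         ≡⟨ cong (_mod n) (*-distribˡ-+ (toℕ x) (toℕ y) (toℕ z)) ⟩
    (toℕ x * toℕ y + toℕ x * toℕ z) mod n   ≡⟨ mod-⊕ (toℕ x * toℕ y) (toℕ x * toℕ z) ⟨
    (x ⊗ y) ⊕ (x ⊗ z)                       ∎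

  ⊗-distribʳ-⊕ : ∀ x y z → (y ⊕ z) ⊗ x ≡ (y ⊗ x) ⊕ (z ⊗ x)
  ⊗-distribʳ-⊕ x y z = begin
    (y ⊕ z) ⊗ x        ≡⟨ ⊗-comm (y ⊕ z) x ⟩
    x ⊗ (y ⊕ z)        ≡⟨ ⊗-distribˡ-⊕ x y z ⟩
    (x ⊗ y) ⊕ (x ⊗ z)  ≡⟨ cong₂ _⊕_ (⊗-comm x y) (⊗-comm x z) ⟩
    (y ⊗ x) ⊕ (z ⊗ x)  ∎

  ℤ/_ : CommutativeRing 0ℓ 0ℓ
  ℤ/_ = record
    { Carrier = Fin n
    ; _≈_     = _≡_
    ; _+_     = _⊕_
    ; _*_     = _⊗_
    ; -_      = ⊖_
    ; 0#      = 0′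
    ; 1#      = 1′
    ; isCommutativeRing = record
      { isRing = record
        { +-isAbelianGroup = record
          { isGroup = record
            { isMonoid = record
              { isSemigroup = record
                { isMagma = record
                  { isEquivalence = isEquivalence
                  ; ∙-cong        = cong₂ _⊕_
                  }
                ; assoc = ⊕-assoc
                }
              ; identity = ⊕-identityˡ , λ x → trans (⊕-comm x 0′) (⊕-identityˡ x)
              }
            ; inverse = ⊖-inverseˡ , λ x → trans (⊕-comm x (⊖ x)) (⊖-inverseˡ x)
            ; ⁻¹-cong = cong ⊖_
            }
          ; comm = ⊕-comm
          }
        ; *-cong     = cong₂ _⊗_
        ; *-assoc    = ⊗-assoc
        ; *-identity = ⊗-identityˡ , λ x → trans (⊗-comm x 1′) (⊗-identityˡ x)
        ; distrib    = ⊗-distribˡ-⊕ , ⊗-distribʳ-⊕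
        }
      ; *-comm = ⊗-comm
      }
    }

  mod-self-inverse : ∀ m → (m * m) % n ≡ 1 % n → IsUnit ℤ/_ (m mod n)
  mod-self-inverse m eq = m mod n , mm≡1 , mm≡1
    where
    mm≡1 : (m mod n) ⊗ (m mod n) ≡ 1′
    mm≡1 = trans (mod-⊗ m m) (mod-cong eq)

open Modular public using (ℤ/_; mod-self-inverse)

ℤ/⁺ : (n : ℕ) .{{_ : NonZero n}} → AbelianGroup 0ℓ 0ℓ
ℤ/⁺ n = CommutativeRing.+-abelianGroup (ℤ/ n)

module _ {n : ℕ} .{{_ : NonZero n}} (G : Subgroup ((ℤ/ n) ˣ) 0ℓ) where

  open CommutativeRing (ℤ/ n) using (1#; *-identityʳ) renaming (_*_ to _·_)
  open Subgroup G

  coset : Fin n → Pred (Fin n) 0ℓ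
  coset r x = ∃ λ g → Member g × x ≡ r · proj₁ g

  -- D_G: a coset is a subset of ℤ/n which equals rG for some r; two
  -- cosets are identified when they have the same elements.
  Cosets : Setoid _ _
  Cosets = subsetoid (≐-setoid (Fin n) 0ℓ) (λ C → ∃ λ r → C ≐ coset r)

  -- C_x = xG, since x = x · 1.
  cosetContaining : Fin n → Setoid.Carrier Cosets
  cosetContaining x = coset x , x , (λ p → p) , (λ p → p)

  ∈-cosetContaining : ∀ x → x ∈ proj₁ (cosetContaining x)
  ∈-cosetContaining x = _ , ε-closed , sym (*-identityʳ x)

  -- A choice of h_G. Being in bijection with the cosets, Fin count has
  -- exactly |D_G| elements.
  record CosetIndexing : Set₁ where
    field
      count : ℕ
      h     : Bijection Cosets (≡-setoid (Fin count))

    open Bijection h using () renaming (to to ⟦_⟧)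

    instance
      count-nonZero : NonZero count
      count-nonZero = nonZeroIndex ⟦ cosetContaining 1# ⟧

    cosetIndex : Func (AbelianGroup.setoid (ℤ/⁺ n)) (AbelianGroup.setoid (ℤ/⁺ count))
    cosetIndex = record
      { to   = λ x → ⟦ cosetContaining x ⟧
      ; cong = cong (λ x → ⟦ cosetContaining x ⟧)
      }

2^[k-1]-1-isUnit : ∀ {k} → k > 2 → let instance _ = m^n≢0 2 k in
                   IsUnit (ℤ/ (2 ^ k)) ((2 ^ (k ∸ 1) ∸ 1) mod (2 ^ k))
2^[k-1]-1-isUnit {suc zero} (s≤s ())
2^[k-1]-1-isUnit {suc (suc j)} _ = mod-self-inverse n m square
  where
  open ≡-Reasoning

  n m e : ℕ
  n = 2 ^ (2 + j)
  m = 2 ^ (1 + j) ∸ 1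
  e = pred (2 ^ j)

  instance
    n≢0 : NonZero n
    n≢0 = m^n≢0 2 (2 + j)

  2^j≡1+e : 2 ^ j ≡ suc e
  2^j≡1+e = sym (suc-pred (2 ^ j) {{m^n≢0 2 j}})

  m≡1+2e : m ≡ 1 + 2 * e
  m≡1+2e = begin
    2 * 2 ^ j ∸ 1  ≡⟨ cong (λ c → 2 * c ∸ 1) 2^j≡1+e ⟩
    2 * suc e ∸ 1  ≡⟨ cong (_∸ 1) (*-suc 2 e) ⟩
    1 + 2 * e      ∎

  expand : (1 + 2 * e) * (1 + 2 * e) ≡ 1 + e * (2 * (2 * suc e))
  expand = solve 1
    (λ x → (con 1 :+ con 2 :* x) :* (con 1 :+ con 2 :* x)
        := con 1 :+ x :* (con 2 :* (con 2 :* (con 1 :+ x))))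
    refl e
    where open +-*-Solver

  square : (m * m) % n ≡ 1 % n
  square = begin
    (m * m) % n                        ≡⟨ cong (_% n) (cong₂ _*_ m≡1+2e m≡1+2e) ⟩
    ((1 + 2 * e) * (1 + 2 * e)) % n    ≡⟨ cong (_% n) expand ⟩
    (1 + e * (2 * (2 * suc e))) % n    ≡⟨ cong (λ c → (1 + e * (2 * (2 * c))) % n) 2^j≡1+e ⟨
    (1 + e * n) % n                    ≡⟨ [m+kn]%n≡m%n 1 e n ⟩
    1 % n                              ∎

{-# OPTIONS --safe #-}
module Submission where

-- Put H = 2^(k-1), n = 2 H and g = H − 1. Then g² ≡ 1, so x and y lie in the
-- same coset iff y = x or y ≡ g x; because H x ≡ −H x modulo n, the latter is
-- the subtraction-free condition n ∣ x + y + H x. The orbits of x ↦ g x are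
-- represented by the even numbers from 0 to H together with all residues
-- congruent to 1 modulo 4, which gives H/2 + 1 + H/2 of them. For d ≠ 0 the
-- condition f(x + d) = f(x) becomes n ∣ 2 x + d + H x: impossible for odd d,
-- and for d = 2 e equivalent to x ≡ −(1 + H/2) e modulo H, a residue class
-- with two members below n.

open import Defs
open import Algebra.Bundles using (AbelianGroup; CommutativeRing; Group)
import Algebra.Properties.Group as GroupProperties
open import Data.Empty using (⊥-elim)
open import Data.Fin.Base
  using (Fin; zero; suc; toℕ; fromℕ<; combine; quotient; remainder)
open import Data.Fin.Properties
  using (toℕ-injective; toℕ-fromℕ<; toℕ<n; toℕ-combine; remQuot-combine;
         combine-remQuot; +↔⊎)
open import Data.Nat.Base
  using (ℕ; zero; suc; _+_; _∸_; _*_; _^_; _≤_; _<_; _>_; z≤n; s≤s; s≤s⁻¹; NonZero;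
         pred; >-nonZero; >-nonZero⁻¹)
open import Data.Nat.DivMod
open import Data.Nat.Divisibility hiding (quotient)
open import Data.Nat.Properties
open import Data.Nat.Tactic.RingSolver using (solve-∀)
open import Data.Product.Base using (∃; _×_; _,_; proj₁; proj₂)
open import Data.Sum.Base as Sum using (_⊎_; inj₁; inj₂; fromInj₂)
open import Function.Base using (_∘_)
open import Function.Bundles
  using (Func; Bijection; _⇔_; mk⇔; Equivalence)
open import Function.Construct.Identity using (bijection)
open import Function.Properties.Inverse using (Inverse⇒Bijection)
open import Function.Construct.Composition using (_⇔-∘_)
open import Function.Construct.Symmetry using (↔-sym; ⇔-sym)
open import Level using (Level; 0ℓ)
open import Relation.Binary.Bundles using (Setoid)
open import Relation.Binary.PropositionalEquality
  using (_≡_; refl; sym; trans; cong; cong₂; subst; subst₂; module ≡-Reasoning)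
  renaming (setoid to ≡-setoid)
open import Relation.Nullary.Decidable using (yes; no; from-no)
open import Relation.Nullary.Negation using (¬_; contradiction)
open import Relation.Unary using (Pred; _∈_; _⊆_; ｛_｝; _∪_)

private
  variable
    a b ℓ p q : Level

-- Sizes of subsets and images.

module _ (S : Setoid a ℓ) where

  private
    module S = Setoid S

  subsetoid-empty : {P : Pred S.Carrier p} → (∀ x → ¬ P x) →
                    subsetoid S P HasSize 0
  subsetoid-empty ¬P = record
    { to        = λ (x , px) → ⊥-elim (¬P x px)
    ; cong      = λ { {x , px} → ⊥-elim (¬P x px) }
    ; bijective = (λ { {x , px} → ⊥-elim (¬P x px) }) , λ ()
    }

  subsetoid-resp-⇔ : ∀ {m} {P : Pred S.Carrier p} {Q : Pred S.Carrier q} →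
                     (∀ x → P x ⇔ Q x) →
                     subsetoid S P HasSize m → subsetoid S Q HasSize m
  subsetoid-resp-⇔ P⇔Q B = record
    { to        = λ (x , qx) → to (x , from′ x qx)
    ; cong      = cong′
    ; bijective = injective , λ j → let ((x , px) , eq) = surjective j in
                    (x , Equivalence.to (P⇔Q x) px) , eq
    }
    where
    open Bijection B renaming (cong to cong′)
    from′ = λ x → Equivalence.from (P⇔Q x)

module _ {A : Setoid a ℓ} {B : Setoid b p} (f : Func A B) where

  private
    module B = Setoid B
    module f = Func f

  -- `s` is a transversal of the fibres of `f`: it meets each nonempty fibre exactly once, so
  -- sending a value to the index of its fibre is a bijection.
  image-HasSize : ∀ {I : Set q} {m} →
    ≡-setoid I HasSize m → (s : I → Setoid.Carrier A) →
    (∀ x → ∃ λ i → f.to x B.≈ f.to (s i)) →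
    (∀ {i j} → f.to (s i) B.≈ f.to (s j) → i ≡ j) →
    subsetoid B (λ y → ∃ λ x → f.to x B.≈ y) HasSize m
  image-HasSize I-size s cover s-injective = record
    { to        = λ (_ , x , _) → I.to (index x)
    ; cong      = λ { {_ , _ , fx≈y} {_ , _ , fx′≈y′} y≈y′ → cong I.to (s-injective
        (B.trans (B.sym (≈-index fx≈y)) (B.trans y≈y′ (≈-index fx′≈y′)))) }
    ; bijective =
        (λ { {_ , _ , fx≈y} {_ , _ , fx′≈y′} eq → B.trans (≈-index fx≈y)
          (B.trans (B.reflexive (cong (f.to ∘ s) (I.injective eq)))
            (B.sym (≈-index fx′≈y′))) })
      , λ j → let (i , to-i) = I.surjective j in (f.to (s i) , s i , B.refl) ,
          λ { {_ , _ , fx≈z} z≈ →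
            to-i (s-injective (B.trans (B.sym (≈-index fx≈z)) z≈)) }
    }
    where
    module I = Bijection I-size

    index = λ x → proj₁ (cover x)

    ≈-index : ∀ {x y} → f.to x B.≈ y → y B.≈ f.to (s (index x))
    ≈-index fx≈y = B.trans (B.sym fx≈y) (proj₂ (cover _))

-- The subgroup generated by a self-inverse element.

module _ {c ℓ} (𝔾 : Group c ℓ) where

  open Group 𝔾 hiding (refl; sym; trans)
  private
    module ≈ = Setoid setoid
  open GroupProperties 𝔾 using (ε⁻¹≈ε; inverseʳ-unique)

  -- The set {ε, g} is closed under products, the only nontrivial one being g ∙ g, and under
  -- inverses, as g is its own inverse.
  Generated-involution : ∀ {g} → g ∙ g ≈ ε → ∀ {x} → Generated 𝔾 g x →
                         x ≈ ε ⊎ x ≈ g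
  Generated-involution gg≈ε gen = inj₂ (≈.refl)
  Generated-involution gg≈ε (≈-gen x≈y x∈) with Generated-involution gg≈ε x∈
  ... | inj₁ x≈ε = inj₁ (≈.trans (≈.sym x≈y) x≈ε)
  ... | inj₂ x≈g = inj₂ (≈.trans (≈.sym x≈y) x≈g)
  Generated-involution gg≈ε ε-gen = inj₁ (≈.refl)
  Generated-involution gg≈ε (∙-gen x∈ y∈)
    with Generated-involution gg≈ε x∈ | Generated-involution gg≈ε y∈
  ... | inj₁ x≈ε | inj₁ y≈ε =
    inj₁ (≈.trans (∙-cong x≈ε y≈ε) (identityˡ ε))
  ... | inj₁ x≈ε | inj₂ y≈g =
    inj₂ (≈.trans (∙-cong x≈ε y≈g) (identityˡ _))
  ... | inj₂ x≈g | inj₁ y≈ε =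
    inj₂ (≈.trans (∙-cong x≈g y≈ε) (identityʳ _))
  ... | inj₂ x≈g | inj₂ y≈g = inj₁ (≈.trans (∙-cong x≈g y≈g) gg≈ε)
  Generated-involution gg≈ε (⁻¹-gen x∈) with Generated-involution gg≈ε x∈
  ... | inj₁ x≈ε = inj₁ (≈.trans (⁻¹-cong x≈ε) ε⁻¹≈ε)
  ... | inj₂ x≈g = inj₂ (≈.trans (⁻¹-cong x≈g)
    (≈.sym (inverseʳ-unique _ _ gg≈ε)))

-- Divisibility and residue classes.

∣-%⇔ : ∀ {n} .{{_ : NonZero n}} c a → n ∣ c + a ⇔ n ∣ c + a % n
∣-%⇔ {n} c a = mk⇔
  (λ n∣ → ∣m+n∣m⇒∣n (subst (n ∣_) split n∣) (n∣m*n (a / n)))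
  (λ n∣ → subst (n ∣_) (sym split) (∣m∣n⇒∣m+n (n∣m*n (a / n)) n∣))
  where
  open ≡-Reasoning
  split : c + a ≡ a / n * n + (c + a % n)
  split = begin
    c + a                     ≡⟨ cong (c +_) (m≡m%n+[m/n]*n a n) ⟩
    c + (a % n + a / n * n)   ≡⟨ +-assoc c _ _ ⟨
    c + a % n + a / n * n     ≡⟨ +-comm (c + a % n) _ ⟩
    a / n * n + (c + a % n)   ∎

-- Both a and b are -c modulo n; by addition alone, a + (c + b) = b + (c + a), where each bracket is
-- a multiple of n.
∣-∣⇒%≡% : ∀ {n} .{{_ : NonZero n}} c {a b} → n ∣ c + a → n ∣ c + b → a % n ≡ b % n
∣-∣⇒%≡% {n} c {a} {b} (divides k c+a≡kn) (divides l c+b≡ln) = begin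
  a % n              ≡⟨ [m+kn]%n≡m%n a l n ⟨
  (a + l * n) % n    ≡⟨ cong (λ e → (a + e) % n) c+b≡ln ⟨
  (a + (c + b)) % n  ≡⟨ cong (_% n) (rearrange a b c) ⟩
  (b + (c + a)) % n  ≡⟨ cong (λ e → (b + e) % n) c+a≡kn ⟩
  (b + k * n) % n    ≡⟨ [m+kn]%n≡m%n b k n ⟩
  b % n              ∎
  where
  open ≡-Reasoning
  rearrange : ∀ a b c → a + (c + b) ≡ b + (c + a)
  rearrange = solve-∀

-- The numbers below q h form q blocks of length h, each with exactly one number congruent to -c
-- modulo h; the block number is the bijection.
residue-class-HasSize : ∀ q h .{{_ : NonZero h}} c →
  subsetoid (≡-setoid (Fin (q * h))) (λ x → h ∣ c + toℕ x) HasSize q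
residue-class-HasSize q h c = record
  { to        = λ (x , _) → quotient h x
  ; cong      = cong (quotient h)
  ; bijective = (λ { {x , x∈} {y , y∈} → injective x y x∈ y∈ })
    , λ i → (combine i r , r∈ i) ,
        λ { refl → cong proj₁ (remQuot-combine i r) }
  }
  where
  open ≡-Reasoning

  -- (h - 1) c represents -c modulo h, since c + (h - 1) c = h c.
  r : Fin h
  r = (pred h * c) mod h

  h∣ : ∀ i j → h ∣ c + toℕ (combine {q} {h} i j) ⇔ h ∣ c + toℕ j
  h∣ i j = mk⇔
    (λ p → ∣m+n∣m⇒∣n (subst (h ∣_) eq p) (m∣m*n (toℕ i)))
    (λ p → subst (h ∣_) (sym eq) (∣m∣n⇒∣m+n (m∣m*n (toℕ i)) p))
    where
    rearrange : ∀ a b c → a + (b + c) ≡ b + (a + c)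
    rearrange = solve-∀
    eq : c + toℕ (combine i j) ≡ h * toℕ i + (c + toℕ j)
    eq = trans (cong (c +_) (toℕ-combine i j)) (rearrange c (h * toℕ i) (toℕ j))

  r∈ : ∀ i → h ∣ c + toℕ (combine {q} {h} i r)
  r∈ i = Equivalence.from (h∣ i r) (subst (λ e → h ∣ c + e)
    (sym (Modular.toℕ-mod h (pred h * c)))
    (Equivalence.to (∣-%⇔ c (pred h * c))
      (subst (λ e → h ∣ e * c) (sym (suc-pred h)) (m∣m*n c))))

  remainder-unique : ∀ {j k : Fin h} → h ∣ c + toℕ j → h ∣ c + toℕ k → j ≡ k
  remainder-unique {j} {k} j∈ k∈ = toℕ-injective (begin
    toℕ j      ≡⟨ m<n⇒m%n≡m (toℕ<n j) ⟨
    toℕ j % h  ≡⟨ ∣-∣⇒%≡% c j∈ k∈ ⟩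
    toℕ k % h  ≡⟨ m<n⇒m%n≡m (toℕ<n k) ⟩
    toℕ k      ∎)

  injective : ∀ x y → h ∣ c + toℕ x → h ∣ c + toℕ y →
              quotient {q} h x ≡ quotient h y → x ≡ y
  injective x y x∈ y∈ eq = begin
    x  ≡⟨ combine-remQuot {q} h x ⟨
    combine (quotient {q} h x) (remainder {q} h x)
       ≡⟨ cong₂ combine eq (remainder-unique (∈-remainder x x∈) (∈-remainder y y∈)) ⟩
    combine (quotient {q} h y) (remainder {q} h y)  ≡⟨ combine-remQuot {q} h y ⟩
    y  ∎
    where
    ∈-remainder : ∀ x → h ∣ c + toℕ x → h ∣ c + toℕ (remainder {q} h x)
    ∈-remainder x x∈ = Equivalence.to (h∣ (quotient {q} h x) (remainder {q} h x))
      (subst (λ z → h ∣ c + toℕ z) (sym (combine-remQuot {q} h x)) x∈)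

-- Cosets and equality of coset indices.

module _ {n} .{{_ : NonZero n}} (G : Subgroup ((ℤ/ n) ˣ) 0ℓ) where

  open Group ((ℤ/ n) ˣ) using (inverseʳ) renaming (_⁻¹ to inv)
  open CommutativeRing (ℤ/ n) using (1#)
    renaming (_*_ to _·_; *-assoc to ·-assoc; *-identityʳ to ·-identityʳ)
  open Subgroup G
  open ≡-Reasoning

  ∈-coset⇒⊆ : ∀ {x y} → y ∈ coset G x → coset G y ⊆ coset G x
  ∈-coset⇒⊆ {x} (g , g∈ , y≡xg) (h , h∈ , z≡yh) =
    _ , ∙-closed g∈ h∈ ,
    trans z≡yh (trans (cong (_· proj₁ h) y≡xg) (·-assoc x (proj₁ g) (proj₁ h)))

  ∈-coset-sym : ∀ {x y} → y ∈ coset G x → x ∈ coset G y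
  ∈-coset-sym {x} {y} (g , g∈ , y≡xg) = inv g , ⁻¹-closed g∈ , (begin
    x                                 ≡⟨ ·-identityʳ x ⟨
    x · 1#                            ≡⟨ cong (x ·_) (inverseʳ g) ⟨
    x · (proj₁ g · proj₁ (inv g))     ≡⟨ ·-assoc x (proj₁ g) (proj₁ (inv g)) ⟨
    x · proj₁ g · proj₁ (inv g)       ≡⟨ cong (_· proj₁ (inv g)) y≡xg ⟨
    y · proj₁ (inv g)                 ∎)

  module _ (I : CosetIndexing G) where

    open CosetIndexing I using (h; cosetIndex)
    open Func cosetIndex using (to)
    private
      module h = Bijection h

    -- As `h` is injective, equal indices mean equal cosets, and y lies in its own coset.
    -- Conversely, membership is symmetric, so each coset includes the other.
    cosetIndex-≡⇔∈ : ∀ x y → to x ≡ to y ⇔ y ∈ coset G x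
    cosetIndex-≡⇔∈ x y = mk⇔
      (λ eq → proj₂ (h.injective eq) (∈-cosetContaining G y))
      (λ y∈ → h.cong {cosetContaining G x} {cosetContaining G y}
        (∈-coset⇒⊆ {y} {x} (∈-coset-sym {x} {y} y∈) , ∈-coset⇒⊆ {x} {y} y∈))

-- Multiplication by H - 1 modulo n = 2 H.

module PowerOfTwo (P : ℕ) .{{P≢0 : NonZero P}} where

  -- Iterated doubling matches the unfolding of `_^_`: for `P` = 2^(k-3), `H` and `n` are 2^(k-1)
  -- and 2^k by computation.
  Q H n : ℕ
  Q = 2 * P
  H = 2 * Q
  n = 2 * H

  instance
    Q≢0 : NonZero Q
    Q≢0 = m*n≢0 2 P
    H≢0 : NonZero H
    H≢0 = m*n≢0 2 Q
    n≢0 : NonZero n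
    n≢0 = m*n≢0 2 H

  H<n : H < n
  H<n = subst (H <_) (*-comm H 2) (m<m*n H 2 (s≤s (s≤s z≤n)))

  open Modular n using (_⊗_; _⊕_; mod-⊗; mod-cong; mod-toℕ; toℕ-mod; 1′; ⊗-comm)

  g : Fin n
  g = (H ∸ 1) mod n

  -- For g = H − 1, b ≡ g a means a + b ≡ H a, and H a ≡ −H a modulo n = 2 H.
  Mirror : ℕ → ℕ → Set
  Mirror a b = n ∣ suc H * a + b

  -- The coefficients H + 1 and H - 1 add up to 2 H = n.
  mirror-multiple : ∀ a → Mirror a ((H ∸ 1) * a)
  mirror-multiple a = subst (n ∣_) (sym eq) (m∣m*n a)
    where
    open ≡-Reasoning
    regroup : ∀ h a → suc (suc h) * a + h * a ≡ 2 * suc h * a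
    regroup = solve-∀
    eq : suc H * a + (H ∸ 1) * a ≡ n * a
    eq = begin
      suc H * a + (H ∸ 1) * a             ≡⟨ cong (λ e → suc e * a + (H ∸ 1) * a) (suc-pred H) ⟨
      suc (suc (pred H)) * a + pred H * a ≡⟨ regroup (pred H) a ⟩
      2 * suc (pred H) * a                ≡⟨ cong (λ e → 2 * e * a) (suc-pred H) ⟩
      n * a                               ∎

  -- The product (H - 1) x satisfies the mirror condition for x, and this condition determines its
  -- second argument modulo n.
  ⊗g⇔Mirror : ∀ x y → y ≡ x ⊗ g ⇔ Mirror (toℕ x) (toℕ y)
  ⊗g⇔Mirror x y = mk⇔
    (λ { refl → subst (Mirror (toℕ x)) (sym (trans (cong toℕ x⊗g) (toℕ-mod _)))
           (Equivalence.to (∣-%⇔ (suc H * toℕ x) _) (mirror-multiple (toℕ x))) })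
    (λ m → trans (sym (mod-toℕ y)) (trans
      (mod-cong (∣-∣⇒%≡% (suc H * toℕ x) m (mirror-multiple (toℕ x)))) (sym x⊗g)))
    where
    x⊗g : x ⊗ g ≡ ((H ∸ 1) * toℕ x) mod n
    x⊗g = trans (⊗-comm x g)
      (trans (cong (g ⊗_) (sym (mod-toℕ x))) (mod-⊗ (H ∸ 1) (toℕ x)))

  4∣H : 4 ∣ H
  4∣H = divides P (eq P)
    where
    eq : ∀ p → 2 * (2 * p) ≡ p * 4
    eq = solve-∀

  -- As 4 divides both n and H, the term H a drops out modulo 4.
  mirror⇒4∣ : ∀ a b → Mirror a b → 4 ∣ a + b
  mirror⇒4∣ a b m = ∣m+n∣m⇒∣n
    (subst (4 ∣_) (eq H a b) (∣-trans (∣n⇒∣m*n 2 4∣H) m)) (∣m⇒∣m*n a 4∣H)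
    where
    eq : ∀ h a b → suc h * a + b ≡ h * a + (a + b)
    eq = solve-∀

  -- Here H (2 s) = n s vanishes modulo n, and the rest, 2 (s + t), is halved along with n. On
  -- halves, mirroring is thus negation modulo H.
  mirror-evens : ∀ s t → Mirror (2 * s) (2 * t) ⇔ H ∣ s + t
  mirror-evens s t = mk⇔
    (λ m → *-cancelˡ-∣ 2 (∣m+n∣m⇒∣n (subst (n ∣_) (eq H s t) m) (m∣m*n s)))
    (λ d → subst (n ∣_) (sym (eq H s t)) (∣m∣n⇒∣m+n (m∣m*n s) (*-monoʳ-∣ 2 d)))
    where
    eq : ∀ h s t → suc h * (2 * s) + 2 * t ≡ 2 * h * s + 2 * (s + t)
    eq = solve-∀

  -- Representatives of the orbits.

  Index : Set
  Index = Fin (suc Q) ⊎ Fin Q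

  -- Negation modulo H fixes both 0 and Q among the halves, hence Q + 1 even orbits; with Q odd ones
  -- this makes 2 Q + 1.
  Index-size : ≡-setoid Index HasSize H + 1
  Index-size = subst (≡-setoid Index HasSize_) (eq Q)
    (Inverse⇒Bijection (↔-sym +↔⊎))
    where
    eq : ∀ q → suc q + q ≡ 2 * q + 1
    eq = solve-∀

  2*t<n : ∀ (t : Fin (suc Q)) → 2 * toℕ t < n
  2*t<n t = ≤-<-trans (*-monoʳ-≤ 2 (s≤s⁻¹ (toℕ<n t))) H<n

  1+4*t<n : ∀ (t : Fin Q) → 1 + 4 * toℕ t < n
  1+4*t<n t = begin-strict
    1 + 4 * toℕ t        <⟨ +-monoˡ-< (4 * toℕ t) {1} {4} (s≤s (s≤s z≤n)) ⟩
    4 + 4 * toℕ t        ≡⟨ *-suc 4 (toℕ t) ⟨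
    4 * suc (toℕ t)      ≤⟨ *-monoʳ-≤ 4 (toℕ<n t) ⟩
    4 * Q                ≡⟨ eq Q ⟩
    n                    ∎
    where
    open ≤-Reasoning
    eq : ∀ q → 4 * q ≡ 2 * (2 * q)
    eq = solve-∀

  -- Mirroring exchanges 1 and 3 modulo 4, so that the odd orbits are
  -- represented by the residues 1 modulo 4.
  representative : Index → Fin n
  representative (inj₁ t) = fromℕ< (2*t<n t)
  representative (inj₂ t) = fromℕ< (1+4*t<n t)

  rep : Index → ℕ
  rep (inj₁ t) = 2 * toℕ t
  rep (inj₂ t) = 1 + 4 * toℕ t

  toℕ-representative : ∀ i → toℕ (representative i) ≡ rep i
  toℕ-representative (inj₁ t) = toℕ-fromℕ< _
  toℕ-representative (inj₂ t) = toℕ-fromℕ< _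

  2∤even+odd : ∀ s t → ¬ 2 ∣ 2 * s + (1 + 4 * t)
  2∤even+odd s t d = from-no (2 ∣? 1)
    (∣m+n∣m⇒∣n (subst (2 ∣_) (eq s t) d) (m∣m*n (s + 2 * t)))
    where
    eq : ∀ s t → 2 * s + (1 + 4 * t) ≡ 2 * (s + 2 * t) + 1
    eq = solve-∀

  -- Keeps the two summands of `Index` apart: an orbit does not mix parities.
  ≡⊎mirror⇒2∣ : ∀ a b → a ≡ b ⊎ Mirror a b → 2 ∣ a + b
  ≡⊎mirror⇒2∣ a _ (inj₁ refl) = divides a (eq a)
    where
    eq : ∀ a → a + a ≡ a * 2
    eq = solve-∀
  ≡⊎mirror⇒2∣ a b (inj₂ m) = ∣-trans (divides 2 refl) (mirror⇒4∣ a b m)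

  -- If t < s ≤ Q, then 0 < s + t < 2 Q = H, which leaves no room for a multiple of H.
  ∣+⇒≤ : ∀ {s t} → s ≤ Q → H ∣ s + t → s ≤ t
  ∣+⇒≤ {s} {t} s≤Q H∣s+t = ≮⇒≥ λ t<s →
    >⇒∤ {{>-nonZero (≤-<-trans z≤n (<-≤-trans t<s (m≤m+n s t)))}}
      (subst (s + t <_) (cong (Q +_) (sym (+-identityʳ Q)))
        (+-mono-≤-< s≤Q (<-≤-trans t<s s≤Q)))
      H∣s+t

  ∣+⇒≡ : ∀ {s t} → s ≤ Q → t ≤ Q → H ∣ s + t → s ≡ t
  ∣+⇒≡ {s} {t} s≤Q t≤Q H∣s+t = ≤-antisym (∣+⇒≤ s≤Q H∣s+t)
    (∣+⇒≤ t≤Q (subst (H ∣_) (+-comm s t) H∣s+t))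

  -- Mirrored evens have halves in 0..Q that are negatives modulo H, hence equal; mixed pairs differ
  -- in parity; two residues 1 modulo 4 add up to 2 modulo 4, so they are never mirrored.
  rep-injective : ∀ i j → rep i ≡ rep j ⊎ Mirror (rep i) (rep j) → i ≡ j
  rep-injective (inj₁ s) (inj₁ t) (inj₁ eq) =
    cong inj₁ (toℕ-injective (*-cancelˡ-≡ _ _ 2 eq))
  rep-injective (inj₁ s) (inj₁ t) (inj₂ m) =
    cong inj₁ (toℕ-injective (∣+⇒≡ (s≤s⁻¹ (toℕ<n s)) (s≤s⁻¹ (toℕ<n t))
      (Equivalence.to (mirror-evens (toℕ s) (toℕ t)) m)))
  rep-injective (inj₁ s) (inj₂ t) e =
    contradiction (≡⊎mirror⇒2∣ (2 * toℕ s) (1 + 4 * toℕ t) e) (2∤even+odd (toℕ s) (toℕ t))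
  rep-injective (inj₂ s) (inj₁ t) e =
    contradiction (subst (2 ∣_) (+-comm (1 + 4 * toℕ s) (2 * toℕ t))
      (≡⊎mirror⇒2∣ (1 + 4 * toℕ s) (2 * toℕ t) e))
      (2∤even+odd (toℕ t) (toℕ s))
  rep-injective (inj₂ s) (inj₂ t) (inj₁ eq) =
    cong inj₂ (toℕ-injective (*-cancelˡ-≡ _ _ 4 (suc-injective eq)))
  rep-injective (inj₂ s) (inj₂ t) (inj₂ m) = contradiction
    (∣m+n∣m⇒∣n (subst (4 ∣_) (eq (toℕ s) (toℕ t)) 
      (mirror⇒4∣ (1 + 4 * toℕ s) (1 + 4 * toℕ t) m)) (m∣m*n (toℕ s + toℕ t)))
    (from-no (4 ∣? 2))
    where
    eq : ∀ s t → 1 + 4 * s + (1 + 4 * t) ≡ 4 * (s + t) + 2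
    eq = solve-∀

  Covered : Fin n → Set
  Covered x = ∃ λ i → representative i ≡ x ⊎ representative i ≡ x ⊗ g

  covered-by : ∀ {x} i → rep i ≡ toℕ x → representative i ≡ x
  covered-by i eq = toℕ-injective (trans (toℕ-representative i) eq)

  -- A half u above Q is replaced by its negative H - u, which is at most Q.
  cover-even : ∀ x u → toℕ x ≡ 2 * u → Covered x
  cover-even x u x≡2u with u ≤? Q
  ... | yes u≤Q = inj₁ u′ , inj₁ (covered-by (inj₁ u′)
    (trans (cong (2 *_) toℕ-u′) (sym x≡2u)))
    where
    u′ = fromℕ< (s≤s u≤Q)
    toℕ-u′ : toℕ u′ ≡ u
    toℕ-u′ = toℕ-fromℕ< (s≤s u≤Q)
  ... | no u≰Q = inj₁ v , inj₂ (Equivalence.from (⊗g⇔Mirror x _)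
    (subst₂ Mirror (sym x≡2u) (sym toℕ-rep-v) (Equivalence.from (mirror-evens u (H ∸ u))
      (∣-reflexive (sym (m+[n∸m]≡n u≤H))))))
    where
    u≤H : u ≤ H
    u≤H = <⇒≤ (*-cancelˡ-< 2 u H (subst (_< n) x≡2u (toℕ<n x)))
    H∸u≤Q : H ∸ u ≤ Q
    H∸u≤Q = m≤n+o⇒m∸n≤o H u (subst (_≤ u + Q) (cong (Q +_) (sym (+-identityʳ Q)))
      (+-monoˡ-≤ Q (≰⇒≥ u≰Q)))
    v = fromℕ< (s≤s H∸u≤Q)
    toℕ-v : toℕ v ≡ H ∸ u
    toℕ-v = toℕ-fromℕ< (s≤s H∸u≤Q)
    toℕ-rep-v : toℕ (representative (inj₁ v)) ≡ 2 * (H ∸ u)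
    toℕ-rep-v = trans (toℕ-representative (inj₁ v)) (cong (2 *_) toℕ-v)

  representative-1mod4 : ∀ x t → toℕ x ≡ 1 + t * 4 → ∃ λ i → representative i ≡ x
  representative-1mod4 x t x≡ = inj₂ t′ , covered-by (inj₂ t′)
    (trans (cong (λ e → 1 + 4 * e) toℕ-t′) (sym x≡1+4t))
    where
    x≡1+4t : toℕ x ≡ 1 + 4 * t
    x≡1+4t = trans x≡ (cong suc (*-comm t 4))
    eq : ∀ q → 2 * (2 * q) ≡ 4 * q
    eq = solve-∀
    t<Q : t < Q
    -- Weakening `1 + 4 * t < n` to `1 + 4 * t ≤ n` yields `4 * t < n` by definition of `_<_`.
    t<Q = *-cancelˡ-< 4 t Q (subst (4 * t <_) (eq Q)
      (<⇒≤ (subst (_< n) x≡1+4t (toℕ<n x))))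
    t′ : Fin Q
    t′ = fromℕ< t<Q
    toℕ-t′ : toℕ t′ ≡ t
    toℕ-t′ = toℕ-fromℕ< t<Q

  cover : ∀ x → Covered x
  cover x with toℕ x divMod 4
  ... | result q zero eq = cover-even x (2 * q) (trans eq (double q))
    where
    double : ∀ q → q * 4 ≡ 2 * (2 * q)
    double = solve-∀
  ... | result q (suc zero) eq =
    let (i , eq′) = representative-1mod4 x q eq in i , inj₁ eq′
  ... | result q (suc (suc zero)) eq = cover-even x (1 + 2 * q) (trans eq (double q))
    where
    double : ∀ q → 2 + q * 4 ≡ 2 * (1 + 2 * q)
    double = solve-∀
  -- For x ≡ 3 modulo 4, divisibility of x + g x by 4 forces remainder 1 on g x, which is then a
  -- representative.
  ... | result q (suc (suc (suc zero))) eq with toℕ (x ⊗ g) divMod 4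
  ...   | result q′ r eq′ = odd r eq′ (∣m+n∣m⇒∣n
      (subst (4 ∣_) (trans (cong₂ _+_ eq eq′) (regroup q q′ (toℕ r)))
        (mirror⇒4∣ (toℕ x) (toℕ (x ⊗ g)) (Equivalence.to (⊗g⇔Mirror x (x ⊗ g)) refl)))
      (n∣m*n (q + q′)))
    where
    regroup : ∀ q q′ r → 3 + q * 4 + (r + q′ * 4) ≡ (q + q′) * 4 + (3 + r)
    regroup = solve-∀
    odd : ∀ r → toℕ (x ⊗ g) ≡ toℕ r + q′ * 4 → 4 ∣ 3 + toℕ r → Covered x
    odd (suc zero) e _ =
      let (i , e′) = representative-1mod4 (x ⊗ g) q′ e in i , inj₂ e′
    odd zero                   _ d = contradiction d (from-no (4 ∣? 3))
    odd (suc (suc zero))       _ d = contradiction d (from-no (4 ∣? 5))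
    odd (suc (suc (suc zero))) _ d = contradiction d (from-no (4 ∣? 6))

  -- Modulo H the left condition is (1 + Q) a + e ≡ 0, and (1 + Q)² ≡ 1.
  mirror-shift : ∀ a e → n ∣ suc H * a + (a + 2 * e) ⇔ H ∣ (1 + Q) * e + a
  mirror-shift a e = mk⇔
    (λ m → ∣m+n∣m⇒∣n
      (subst (H ∣_) (unfold P a e)
        (∣n⇒∣m*n (1 + Q) (*-cancelˡ-∣ 2 (subst (n ∣_) (halve P a e) m))))
      (m∣m*n ((1 + P) * a)))
    (λ d → subst (n ∣_) (sym (halve P a e)) (*-monoʳ-∣ 2
      (∣m+n∣m⇒∣n (subst (H ∣_) (fold P a e) (∣n⇒∣m*n (1 + Q) d)) (m∣m*n ((1 + P) * e)))))
    where
    halve : ∀ p a e → suc (2 * (2 * p)) * a + (a + 2 * e) ≡ 2 * ((1 + 2 * p) * a + e)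
    halve = solve-∀
    -- The cofactor 1 + P comes from (1 + Q)² = 1 + H (1 + P).
    unfold : ∀ p a e → (1 + 2 * p) * ((1 + 2 * p) * a + e) ≡
             2 * (2 * p) * ((1 + p) * a) + ((1 + 2 * p) * e + a)
    unfold = solve-∀
    fold : ∀ p a e → (1 + 2 * p) * ((1 + 2 * p) * e + a) ≡
           2 * (2 * p) * ((1 + p) * e) + ((1 + 2 * p) * a + e)
    fold = solve-∀

  -- The coset index function of the subgroup generated by g.

  module _ (u : IsUnit (ℤ/ n) g) where

    G = ⟨ (ℤ/ n) ˣ ⟩ (g , u)

    -- The mirror condition reads (H + 1)(H - 1) + 1 = H², and H² = n Q because H = 2 Q and n = 2 H.
    g⊗g≡1 : g ⊗ g ≡ 1′
    g⊗g≡1 = sym (Equivalence.from (⊗g⇔Mirror g 1′) g-mirror-1)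
      where
      open ≡-Reasoning
      H>0 = >-nonZero⁻¹ H
      toℕ-g : toℕ g ≡ H ∸ 1
      toℕ-g = trans (toℕ-mod (H ∸ 1)) (m<n⇒m%n≡m (≤-<-trans (m∸n≤m H 1) H<n))
      toℕ-1′ : toℕ 1′ ≡ 1
      toℕ-1′ = trans (toℕ-mod 1) (m<n⇒m%n≡m (≤-<-trans H>0 H<n))
      regroup : ∀ h → suc (suc h) * h + 1 ≡ suc h * suc h
      regroup = solve-∀
      square : ∀ p → 2 * (2 * p) * (2 * (2 * p)) ≡ 2 * (2 * (2 * p)) * (2 * p)
      square = solve-∀
      g-mirror-1 : Mirror (toℕ g) (toℕ 1′)
      g-mirror-1 = divides Q (begin
        suc H * toℕ g + toℕ 1′            ≡⟨ cong₂ (λ a b → suc H * a + b) toℕ-g toℕ-1′ ⟩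
        suc H * (H ∸ 1) + 1               ≡⟨ cong (λ e → suc e * (H ∸ 1) + 1) (suc-pred H) ⟨
        suc (suc (pred H)) * pred H + 1   ≡⟨ regroup (pred H) ⟩
        suc (pred H) * suc (pred H)       ≡⟨ cong (λ e → e * e) (suc-pred H) ⟩
        H * H                             ≡⟨ square P ⟩
        n * Q                             ≡⟨ *-comm n Q ⟩
        Q * n                             ∎)

    -- As g² = 1, the subgroup has no elements besides 1 and g.
    ∈-coset⇔ : ∀ x y → y ∈ coset G x ⇔ (y ≡ x ⊎ y ≡ x ⊗ g)
    ∈-coset⇔ x y = mk⇔ to
      (λ { (inj₁ refl) → ∈-cosetContaining G x ; (inj₂ eq) → (g , u) , gen , eq })
      where
      to : y ∈ coset G x → y ≡ x ⊎ y ≡ x ⊗ g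
      to (h , h∈ , y≡xh) = Sum.map
        (λ h≡1 → trans y≡xh (trans (cong (x ⊗_) h≡1)
          (CommutativeRing.*-identityʳ (ℤ/ n) x)))
        (λ h≡g → trans y≡xh (cong (x ⊗_) h≡g))
        (Generated-involution ((ℤ/ n) ˣ) g⊗g≡1 h∈)

    module _ (I : CosetIndexing G) where

      open CosetIndexing I
      open Func cosetIndex using (to)

      to-≡⇔ : ∀ x y → to x ≡ to y ⇔ (y ≡ x ⊎ y ≡ x ⊗ g)
      to-≡⇔ x y = ∈-coset⇔ x y ⇔-∘ cosetIndex-≡⇔∈ G I x y

      image-count : subsetoid (≡-setoid (Fin count)) (λ y → ∃ λ x → to x ≡ y) HasSize H + 1
      image-count = image-HasSize cosetIndex Index-size representative
        (λ x → let (i , eq) = cover x in i , Equivalence.from (to-≡⇔ x (representative i)) eq)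
        (λ {i} {j} eq → rep-injective i j (compare i j
          (Equivalence.to (to-≡⇔ (representative i) (representative j)) eq)))
        where
        compare : ∀ i j → let x = representative i; y = representative j in
                  y ≡ x ⊎ y ≡ x ⊗ g → rep i ≡ rep j ⊎ Mirror (rep i) (rep j)
        compare i j = Sum.map
          (λ eq → trans (sym (toℕ-representative i))
            (trans (cong toℕ (sym eq)) (toℕ-representative j)))
          (λ eq → subst₂ Mirror (toℕ-representative i) (toℕ-representative j)
            (Equivalence.to (⊗g⇔Mirror (representative i) (representative j)) eq))

      -- Since d ≠ 0 rules out x + d = x, only x + d = g x remains, and the mirror condition does
      -- not see the reduction of x + d modulo n.
      shift-invariant⇔ : ∀ d → ¬ d ≡ 0 mod n → ∀ x →
        to (x ⊕ d) ≡ to x ⇔ n ∣ suc H * toℕ x + (toℕ x + toℕ d)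
      shift-invariant⇔ d d≢0 x = mk⇔
        (λ eq → Equivalence.from %⇔ (subst (Mirror (toℕ x)) toℕ-x⊕d
          (Equivalence.to (⊗g⇔Mirror x (x ⊕ d)) (x⊕d≡xg (sym eq)))))
        (λ m → sym (Equivalence.from (to-≡⇔ x (x ⊕ d)) (inj₂
          (Equivalence.from (⊗g⇔Mirror x (x ⊕ d))
            (subst (Mirror (toℕ x)) (sym toℕ-x⊕d) (Equivalence.to %⇔ m))))))
        where
        %⇔ = ∣-%⇔ {n} (suc H * toℕ x) (toℕ x + toℕ d)
        toℕ-x⊕d : toℕ (x ⊕ d) ≡ (toℕ x + toℕ d) % n
        toℕ-x⊕d = toℕ-mod (toℕ x + toℕ d)
        x⊕d≡xg : to x ≡ to (x ⊕ d) → x ⊕ d ≡ x ⊗ g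
        x⊕d≡xg eq = fromInj₂
          (λ x⊕d≡x → contradiction (identityʳ-unique x d x⊕d≡x) d≢0)
          (Equivalence.to (to-≡⇔ x (x ⊕ d)) eq)
          where
          open GroupProperties (AbelianGroup.group (ℤ/⁺ n)) using (identityʳ-unique)

      shift-invariant-count : ∀ d → ¬ d ≡ 0 mod n → ∃ λ s → s ∈ ｛ 0 ｝ ∪ ｛ 2 ｝ ×
        subsetoid (≡-setoid (Fin n)) (λ x → to (x ⊕ d) ≡ to x) HasSize s
      shift-invariant-count d d≢0 = by-parity (toℕ d divMod 2)
        where
        regroup : ∀ a e → a + (a + (1 + e * 2)) ≡ 2 * (a + e) + 1
        regroup = solve-∀

        odd : ∀ e a → ¬ 4 ∣ a + (a + (1 + e * 2))
        odd e a 4∣ = from-no (2 ∣? 1) (∣m+n∣m⇒∣n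
          (∣-trans (divides 2 refl) (subst (4 ∣_) (regroup a e) 4∣)) (m∣m*n (a + e)))

        class⇔ : ∀ e → toℕ d ≡ 2 * e → ∀ x →
                 H ∣ (1 + Q) * e + toℕ x ⇔ to (x ⊕ d) ≡ to x
        class⇔ e d≡2e x = ⇔-sym (mirror-shift (toℕ x) e ⇔-∘
          subst (λ t → to (x ⊕ d) ≡ to x ⇔ n ∣ suc H * toℕ x + (toℕ x + t))
            d≡2e (shift-invariant⇔ d d≢0 x))

        by-parity : DivMod (toℕ d) 2 → ∃ λ s → s ∈ ｛ 0 ｝ ∪ ｛ 2 ｝ ×
          subsetoid (≡-setoid (Fin n)) (λ x → to (x ⊕ d) ≡ to x) HasSize s
        by-parity (result e zero d≡e*2) = 2 , inj₂ refl ,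
          subsetoid-resp-⇔ (≡-setoid (Fin n))
            (class⇔ e (trans d≡e*2 (*-comm e 2)))
            -- By definition n is 2 * H, so `Fin n` consists of two periods of length H.
            (residue-class-HasSize 2 H ((1 + Q) * e))
        -- For odd d the sum x + (x + d) is odd, whereas a mirror pair adds up to a multiple of 4.
        by-parity (result e (suc zero) d≡1+e*2) = 0 , inj₁ refl ,
          subsetoid-empty (≡-setoid (Fin n)) λ x eq → odd e (toℕ x)
            (subst (λ t → 4 ∣ toℕ x + (toℕ x + t)) d≡1+e*2
              (mirror⇒4∣ (toℕ x) (toℕ x + toℕ d)
                (Equivalence.to (shift-invariant⇔ d d≢0 x) eq)))

      isZeroDifference : IsZeroDifference (ℤ/⁺ n) (ℤ/⁺ count) n (H + 1)
                           (｛ 0 ｝ ∪ ｛ 2 ｝) cosetIndex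
      isZeroDifference = record
        { domain-size     = bijection _
        ; codomain-finite = count , bijection _
        ; image-size      = image-count
        ; zero-difference = shift-invariant-count
        }

theorem3p4 :
    (k : ℕ) (k>2 : k > 2) →
    let n = 2 ^ k
        instance n≢0 = m^n≢0 2 k
        G = ⟨_⟩ ((ℤ/ n) ˣ) ((2 ^ (k ∸ 1) ∸ 1) mod n , 2^[k-1]-1-isUnit k>2)
    in (I : CosetIndexing G) →
       let open CosetIndexing I
       in IsZeroDifference (ℤ/⁺ n) (ℤ/⁺ count)
            (2 ^ k) (2 ^ (k ∸ 1) + 1) (｛ 0 ｝ ∪ ｛ 2 ｝) cosetIndex
-- Matching on `k>2` leaves only k = i + 3, so `P` is 2^i.
theorem3p4 (suc (suc (suc i))) k>2@(s≤s (s≤s (s≤s z≤n))) =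
  PowerOfTwo.isZeroDifference (2 ^ i) {{m^n≢0 2 i}} (2^[k-1]-1-isUnit k>2)
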